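{- Let $X=(V,E)$ be any digraph with vertices labeled $v_1,v_2,\ldots,v_n$ and let $e=(v_{n-1},v_n)$ be an edge of $X$. Then $$W_X=W_{X\setminus e}-W_{X/e}\uparrow,$$ where the vertices of $X\setminus e$ are labeled as in $X$, and the vertices of $X/e$ are labeled $v_1,\ldots,v_{n-2},v_{n-1}$ with the vertex obtained by the contraction labeled $v_{n-1}$ and the remaining vertices keeping their labels.
   Context: A digraph is a pair $X=(V,E)$ with $V$ a finite set and $E\subseteq V\times V$ (loops are allowed). Write $\mathbb{P}$ for the set of positive integers. If $|V|=n$, a $V$-listing is a bijection $\sigma:[n]\to V$, written $\sigma=(\sigma_1,\ldots,\sigma_n)$; $\Sigma_V$ is the set of all $V$-listings. For a coloring $f:V\to\mathbb{P}$, a $V$-listing $\sigma$ is $(f,X)$-friendly if $f(\sigma_1)\le f(\sigma_2)\le\cdots\le f(\sigma_n)$ and $f(\sigma_j)<f(\sigma_{j+1})$ for each $j\in[n-1]$ with $(\sigma_j,\sigma_{j+1})\in E$. Let $\Sigma_V(f,X)$ be the set of $(f,X)$-friendly $V$-listings. For a digraph $X$ with vertices labeled $v_1,\ldots,v_n$ in a fixed order, the Redei-Berge function in noncommuting variables is the formal power series in noncommuting variables $x_1,x_2,\ldots$ $$W_X=\sum_{f:V\to\mathbb{P}}\#\Sigma_V(f,X)\; x_{f(v_1)}x_{f(v_2)}\cdots x_{f(v_n)}.$$ Deletion: $X\setminus e=(V,E\setminus\{e\})$. Contraction of $X$ by $e=(u,v)\in E$ ($u\ne v$): $X/e=(V',E')$,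 where $V'=(V\setminus\{u,v\})\cup\{e\}$ and $E'$ consists of all edges in $E$ both of whose endpoints are different from $u,v$, together with, for $w\ne u,v$: $(w,e)\in E'$ if and only if $(w,u)\in E$, and $(e,w)\in E'$ if and only if $(v,w)\in E$ (there is no loop at $e$). The induction operation $\uparrow$ is defined on monomials of degree $n-1$ by $(x_{i_1}x_{i_2}\cdots x_{i_{n-2}}x_{i_{n-1}})\uparrow=x_{i_1}x_{i_2}\cdots x_{i_{n-2}}x_{i_{n-1}}^2$ and extended linearly (to possibly infinite sums of monomials). -}

module Defs where

open import Data.Empty using (⊥; ⊥-elim-irr)
open import Data.Fin.Base using (Fin; fromℕ; inject₁; cast)
import Data.Fin.Properties as Fin
open import Data.Fin.Relation.Unary.Top using (view; view-fromℕ; view-inject₁; ‵fromℕ; ‵inject₁)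
open import Data.Integer.Base as ℤ using (ℤ; +_; 0ℤ)
open import Data.List.Base as List
  using (List; []; _∷_; length; filter; cartesianProductWith; last; initLast; _∷ʳ′_)
import Data.List.Properties as List
open import Data.Maybe.Base using (just)
import Data.Maybe.Properties as Maybe
import Data.Nat.Properties as ℕ
open import Data.Nat.Base using (ℕ; zero; suc; _+_; _<_; _≤_)
open import Data.Product.Base using (Σ; _×_; _,_; ∃)
open import Data.Product.Properties using (≡-dec)
open import Data.Refinement using (Refinement-syntax; value)
open import Data.Refinement.Properties using (value-injective)
open import Data.Vec.Base using (Vec; []; _∷_; lookup)
open import Data.Vec.Relation.Unary.Linked using (Linked; linked?)
import Data.Vec.Relation.Unary.Linked as Linked
open import Function.Base using (_∘_)
open import Function.Bundles using (_↔_; mk↔ₛ′; Inverse)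
open import Function.Definitions using (Bijective)
open import Level using (0ℓ)
open import Relation.Binary.Definitions using (DecidableEquality)
open import Relation.Binary.PropositionalEquality
  using (_≡_; _≢_; _≗_; refl; sym; trans; cong; subst; subst₂)
open import Relation.Nullary using (Dec; yes; no; contradiction)
open import Relation.Nullary.Decidable using (map′; _×-dec_; _→-dec_; ¬?)
open import Relation.Unary using (Pred; Decidable)

open Inverse using (to; from; strictlyInverseˡ; strictlyInverseʳ)

private
  variable
    m n : ℕ

ℙ : Set
ℙ = [ k ∈ ℕ ∣ 0 < k ]

_≟ℙ_ : DecidableEquality ℙ
a ≟ℙ b = map′ value-injective (cong value) (value a ℕ.≟ value b)

-- Finiteness of V is not a field: it is supplied by a labelling.
record Digraph : Set₁ where
  field
    V   : Set
    E   : Pred (V × V) 0ℓ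
    _≟_ : DecidableEquality V
    E?  : Decidable E

open Digraph using (V)

-- A labelling v₁, …, vₙ of the vertices, so in particular |V| = n.
Labelling : ℕ → Digraph → Set
Labelling n X = Fin n ↔ V X

Coloring : Digraph → Set
Coloring X = V X → ℙ

infixl 7 _∖_ _/_

_∖_ : (X : Digraph) → V X × V X → Digraph
X ∖ e = record
  { V   = X.V
  ; E   = λ d → X.E d × d ≢ e
  ; _≟_ = X._≟_
  ; E?  = λ d → X.E? d ×-dec ¬? (≡-dec X._≟_ X._≟_ d e)
  } where module X = Digraph X

-- (A ∖ {u , v}) ∪ {e}.  The proofs are irrelevant, so every vertex of A
-- other than u and v is kept exactly once.
data Contracted {A : Set} (u v : A) : Set where
  kept   : (w : A) → .(w ≢ u) → .(w ≢ v) → Contracted u v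
  merged : Contracted u v

_/_ : (X : Digraph) → V X × V X → Digraph
X / (u , v) = record
  { V   = Contracted u v
  ; E   = E′
  ; _≟_ = _≟′_
  ; E?  = E′?
  } where
  open Digraph X using (E; E?; _≟_)

  E′ : Pred (Contracted u v × Contracted u v) 0ℓ
  E′ (kept w _ _ , kept w′ _ _) = E (w , w′)
  E′ (kept w _ _ , merged)      = E (w , u)
  E′ (merged     , kept w _ _)  = E (v , w)
  E′ (merged     , merged)      = ⊥

  E′? : Decidable E′
  E′? (kept w _ _ , kept w′ _ _) = E? (w , w′)
  E′? (kept w _ _ , merged)      = E? (w , u)
  E′? (merged     , kept w _ _)  = E? (v , w)
  E′? (merged     , merged)      = no λ ()

  _≟′_ : DecidableEquality (Contracted u v)
  kept w _ _ ≟′ kept w′ _ _ = map′ (λ { refl → refl }) (λ { refl → refl }) (w ≟ w′)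
  kept _ _ _ ≟′ merged      = no λ ()
  merged     ≟′ kept _ _ _  = no λ ()
  merged     ≟′ merged      = yes refl

penultimate : ∀ m → Fin (2 + m)
penultimate m = inject₁ (fromℕ m)

ultimate : ∀ m → Fin (2 + m)
ultimate m = fromℕ (suc m)

-- (vₙ₋₁ , vₙ), for n = m + 2.
lastPair : ∀ X → Labelling (2 + m) X → V X × V X
lastPair {m} X v = to v (penultimate m) , to v (ultimate m)

inject₁≢penultimate : (k : Fin m) → inject₁ (inject₁ k) ≢ penultimate m
inject₁≢penultimate k eq = Fin.fromℕ≢inject₁ (sym (Fin.inject₁-injective eq))

inject₁≢ultimate : (k : Fin m) → inject₁ (inject₁ k) ≢ ultimate m
inject₁≢ultimate k eq = Fin.fromℕ≢inject₁ (sym eq)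

lower : (i : Fin (2 + m)) → .(i ≢ penultimate m) → .(i ≢ ultimate m) → Fin m
lower i p q with view i
... | ‵fromℕ = ⊥-elim-irr (q refl)
... | ‵inject₁ j with view j
...   | ‵fromℕ     = ⊥-elim-irr (p refl)
...   | ‵inject₁ k = k

inject₁-lower : (i : Fin (2 + m)) .(p : i ≢ penultimate m) .(q : i ≢ ultimate m) →
                inject₁ (inject₁ (lower i p q)) ≡ i
inject₁-lower i p q with view i
... | ‵fromℕ = ⊥-elim-irr (q refl)
... | ‵inject₁ j with view j
...   | ‵fromℕ     = ⊥-elim-irr (p refl)
...   | ‵inject₁ k = refl

to-injective : ∀ {A B : Set} (v : A ↔ B) {x y} → to v x ≡ to v y → x ≡ y
to-injective v {x} {y} eq =
  trans (sym (strictlyInverseʳ v x)) (trans (cong (from v) eq) (strictlyInverseʳ v y))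

-- v₁, …, vₙ₋₂ keep their labels and the merged vertex comes last; see
-- contractLabelling-kept and contractLabelling-merged below.
contractLabelling : ∀ X (v : Labelling (2 + m) X) →
                    Labelling (1 + m) (X / lastPair X v)
contractLabelling {m} X v = mk↔ₛ′ to′ from′ to′∘from′ from′∘to′
  where
  V′ : Set
  V′ = V (X / lastPair X v)

  keep : Fin m → V′
  keep k = kept (to v (inject₁ (inject₁ k)))
                (inject₁≢penultimate k ∘ to-injective v)
                (inject₁≢ultimate k ∘ to-injective v)

  to′ : Fin (1 + m) → V′
  to′ i with view i
  ... | ‵fromℕ     = merged
  ... | ‵inject₁ k = keep k

  from≢ : ∀ {w i} → w ≢ to v i → from v w ≢ i
  from≢ w≢ eq = w≢ (trans (sym (strictlyInverseˡ v _)) (cong (to v) eq))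

  from′ : V′ → Fin (1 + m)
  from′ (kept w p q) = inject₁ (lower (from v w) (from≢ p) (from≢ q))
  from′ merged       = fromℕ m

  kept-cong : ∀ {w w′} .{p q p′ q′} → w ≡ w′ → _≡_ {A = V′} (kept w p q) (kept w′ p′ q′)
  kept-cong refl = refl

  to′∘from′ : ∀ w → to′ (from′ w) ≡ w
  to′∘from′ merged rewrite view-fromℕ m = refl
  to′∘from′ (kept w p q)
    rewrite view-inject₁ (lower (from v w) (from≢ p) (from≢ q)) =
    kept-cong (trans (cong (to v) (inject₁-lower (from v w) (from≢ p) (from≢ q)))
                     (strictlyInverseˡ v w))

  from′∘to′ : ∀ i → from′ (to′ i) ≡ i
  from′∘to′ i with view i
  ... | ‵fromℕ     = refl
  ... | ‵inject₁ k = cong inject₁ (Fin.inject₁-injective (Fin.inject₁-injective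
          (trans (inject₁-lower _ _ _) (strictlyInverseʳ v _))))

contractLabelling-kept :
  ∀ X (v : Labelling (2 + m) X) (k : Fin m) →
  Σ (to v (inject₁ (inject₁ k)) ≢ to v (penultimate m)) λ p →
  Σ (to v (inject₁ (inject₁ k)) ≢ to v (ultimate m)) λ q →
  to (contractLabelling X v) (inject₁ k) ≡ kept (to v (inject₁ (inject₁ k))) p q
contractLabelling-kept X v k
  rewrite view-inject₁ k =
  inject₁≢penultimate k ∘ to-injective v , inject₁≢ultimate k ∘ to-injective v , refl

contractLabelling-merged : ∀ X (v : Labelling (2 + m) X) →
                           to (contractLabelling X v) (fromℕ m) ≡ merged
contractLabelling-merged {m} X v rewrite view-fromℕ m = refl

IsListing : (X : Digraph) → Vec (V X) n → Set
IsListing X σ = Bijective _≡_ _≡_ (lookup σ)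

Friendly : (X : Digraph) → Coloring X → Vec (V X) n → Set
Friendly X f σ =
  Linked (λ x y → value (f x) ≤ value (f y)) σ ×
  Linked (λ x y → E (x , y) → value (f x) < value (f y)) σ
  where open Digraph X using (E)

isListing? : ∀ X → Labelling n X → Decidable (IsListing {n} X)
isListing? {n} X v σ = injective? ×-dec surjective?
  where
  open Digraph X using (_≟_)

  injective? : Dec (∀ {i j} → lookup σ i ≡ lookup σ j → i ≡ j)
  injective? = map′ (λ h {i} {j} → h i j) (λ h i j → h)
    (Fin.all? λ i → Fin.all? λ j → (lookup σ i ≟ lookup σ j) →-dec (i Fin.≟ j))

  Hit : V X → Set
  Hit x = ∃ λ i → ∀ {j} → j ≡ i → lookup σ j ≡ x

  surjective? : Dec (∀ x → Hit x)
  surjective? = map′ (λ h x → subst Hit (strictlyInverseˡ v x) (h (from v x))) (λ h → h ∘ to v)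
    (Fin.all? λ k → map′ (λ { (i , eq) → i , λ { refl → eq } }) (λ { (i , h) → i , h refl })
      (Fin.any? λ i → lookup σ i ≟ to v k))

friendly? : ∀ X f → Decidable (Friendly {n} X f)
friendly? X f σ =
  linked? (λ x y → value (f x) ℕ.≤? value (f y)) σ ×-dec
  linked? (λ x y → E? (x , y) →-dec (value (f x) ℕ.<? value (f y))) σ
  where open Digraph X using (E?)

words : ∀ {A : Set} n → List A → List (Vec A n)
words zero    as = [] ∷ []
words (suc n) as = cartesianProductWith _∷_ as (words n as)

-- The labelling v only serves to enumerate the vertices; it has no
-- repetitions, so neither has the list of listings.
listings : ∀ X → Labelling n X → List (Vec (V X) n)
listings {n} X v = filter (isListing? X v) (words n (List.tabulate (to v)))

#friendly : ∀ X → Labelling n X → Coloring X → ℕ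
#friendly X v f = length (filter (friendly? X f) (listings X v))

-- A word x_{i₁} ⋯ x_{iₖ} in the noncommuting variables x₁, x₂, … is the
-- list i₁, …, iₖ.
Monomial : Set
Monomial = List ℙ

-- A series is the family of its coefficients.
Series : Set
Series = Monomial → ℤ

infixl 6 _-_
infixl 8 _↑

_-_ : Series → Series → Series
(F - G) w = F w ℤ.- G w

-- The only monomial that ↑ can send to u ∷ʳ b is u, and it does so
-- exactly when u ends in b.  A constant term, on which ↑ is undefined,
-- is discarded.
_↑ : Series → Series
(F ↑) w with initLast w
... | []      = 0ℤ
... | u ∷ʳ′ b with Maybe.≡-dec _≟ℙ_ (last u) (just b)
...   | yes _ = F u
...   | no  _ = 0ℤ

colorMonomial : ∀ X → Labelling n X → Coloring X → Monomial
colorMonomial X v f = List.tabulate (f ∘ to v)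

-- The colorings f contributing to the coefficient of w are those with
-- f(v₁), …, f(vₙ) = w: there is exactly one if w has degree n, namely
-- vᵢ ↦ wᵢ, and none otherwise.  See W-coefficient and W-otherwise.
W : ∀ X → Labelling n X → Series
W {n} X v w with length w ℕ.≟ n
... | yes |w|≡n = + #friendly X v (λ x → List.lookup w (cast (sym |w|≡n) (from v x)))
... | no  _     = 0ℤ

#friendly-cong : ∀ X (v : Labelling n X) {f g : Coloring X} → f ≗ g →
                 #friendly X v f ≡ #friendly X v g
#friendly-cong {n} X v {f} {g} f≗g =
  cong length (List.filter-≐ (friendly? X f) (friendly? X g)
    (transport f≗g , transport (sym ∘ f≗g)) (listings X v))
  where
  transport : ∀ {f g : Coloring X} → f ≗ g → ∀ {σ : Vec (V X) n} →
              Friendly X f σ → Friendly X g σ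
  transport eq (p , q) =
    Linked.map (subst₂ (λ a b → value a ≤ value b) (eq _) (eq _)) p ,
    Linked.map (λ h e → subst₂ (λ a b → value a < value b) (eq _) (eq _) (h e)) q

W-coefficient : ∀ X (v : Labelling n X) (f : Coloring X) →
                W X v (colorMonomial X v f) ≡ + #friendly X v f
W-coefficient {n} X v f with length (colorMonomial X v f) ℕ.≟ n
... | yes eq = cong +_ (#friendly-cong X v λ x →
        trans (lookup-tabulate (f ∘ to v) (from v x) (sym eq)) (cong f (strictlyInverseˡ v x)))
  where
  lookup-tabulate : ∀ {k} (g : Fin k → ℙ) (i : Fin k) .(p : k ≡ length (List.tabulate g)) →
                    List.lookup (List.tabulate g) (cast p i) ≡ g i
  lookup-tabulate g Fin.zero    p = refl
  lookup-tabulate g (Fin.suc i) p = lookup-tabulate (g ∘ Fin.suc) i (ℕ.suc-injective p)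
... | no ≢n = contradiction (List.length-tabulate (f ∘ to v)) ≢n

W-otherwise : ∀ X (v : Labelling n X) w → (∀ f → w ≢ colorMonomial X v f) → W X v w ≡ 0ℤ
W-otherwise {n} X v w w≢ with length w ℕ.≟ n
... | no  _    = refl
... | yes refl = contradiction
        (sym (trans (List.tabulate-cong (λ i → cong (List.lookup w) (strictlyInverseʳ v i)))
                    (List.tabulate-lookup w)))
        (w≢ (List.lookup w ∘ from v))

{-# OPTIONS --safe #-}

-- Compare coefficients at x_{f(v₁)} ⋯ x_{f(vₙ)}, with e = (u , v).  A
-- listing friendly for X is friendly for X ∖ e.  A listing friendly for
-- X ∖ e fails to be friendly for X exactly when u and v are adjacent in it,
-- in this order, and f u = f v.  Fusing the adjacent u , v into one entry
-- matches these listings with the friendly listings of X / e, and f u = f v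
-- says that the monomial ends in a square, i.e. lies in the image of ↑.
module Submission where

open import Defs
import Data.Integer.Properties as ℤ
open import Algebra.Properties.AbelianGroup ℤ.+-0-abelianGroup using (//-rightDividesʳ)
open import Data.Empty using (⊥-elim-irr)
open import Data.Fin.Base using (Fin; zero; suc; fromℕ; inject₁; punchOut)
import Data.Fin.Properties as Fin
open import Data.Fin.Relation.Unary.Top using (view; ‵fromℕ; ‵inject₁)
open import Data.Integer.Base as ℤ using (0ℤ)
open import Data.List.Base as List using (List; []; _∷_; _∷ʳ_; _++_; length; filter; last; initLast; _∷ʳ′_)
import Data.List.Properties as List
open import Data.List.Membership.Propositional using (_∈_)
import Data.List.Membership.Propositional.Properties as ∈
open import Data.List.Membership.Propositional.Properties.WithK using (unique∧set⇒bag)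
open import Data.List.Relation.Binary.BagAndSetEquality using (∼bag⇒↭)
open import Data.List.Relation.Binary.Permutation.Propositional.Properties using (↭-length)
open import Data.List.Relation.Unary.Any using (here)
open import Data.List.Relation.Unary.Unique.Propositional using ([]; _∷_) renaming (Unique to Uniqueˡ)
import Data.List.Relation.Unary.Unique.Propositional.Properties as Uniqueˡ
import Data.List.Relation.Unary.All as Allˡ
open import Data.Maybe.Base using (just)
import Data.Maybe.Properties as Maybe
open import Data.Nat.Base using (ℕ; zero; suc; _+_; _<_; _≤_)
import Data.Nat.Properties as ℕ
open import Data.Product.Base using (_×_; _,_; ∃; proj₁; proj₂)
open import Data.Refinement using (value)
open import Data.Refinement.Properties using (value-injective)
open import Data.Sum.Base using (_⊎_; inj₁; inj₂)
open import Data.Vec.Base as Vec using (Vec; []; _∷_; lookup)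
import Data.Vec.Properties as Vec
open import Data.Vec.Membership.Propositional using () renaming (_∈_ to _∈ᵛ_)
import Data.Vec.Membership.Propositional.Properties as ∈ᵛ
open import Data.Vec.Relation.Unary.All as All using (All; []; _∷_)
import Data.Vec.Relation.Unary.All.Properties as All
open import Data.Vec.Relation.Unary.Any using (here; there)
open import Data.Vec.Relation.Unary.Linked as Linked using (Linked; []; [-]; _∷_)
open import Data.Vec.Relation.Unary.Unique.Propositional using (Unique; []; _∷_)
import Data.Vec.Relation.Unary.Unique.Propositional.Properties as Unique
open import Function.Base using (_∘_; id; case_of_)
open import Function.Bundles using (Inverse; mk⇔)
open import Function.Definitions using (Injective)
open import Relation.Binary.PropositionalEquality
  using (_≡_; _≢_; _≗_; refl; sym; trans; cong; cong₂; subst)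
open import Relation.Nullary using (¬_; yes; no; contradiction)

open Digraph using (V; E)
open Inverse using (to; from; strictlyInverseˡ; strictlyInverseʳ)

private
  variable
    n : ℕ
    A : Set

-- Listings as repetition-free vectors

injective⇒hits : (g : Fin n → Fin n) → Injective _≡_ _≡_ g → ∀ y → ∃ λ i → g i ≡ y
injective⇒hits {suc n} g inj y with Fin.any? (λ i → g i Fin.≟ y)
... | yes hit = hit
-- If `y` were missed, punching it out would inject `Fin (suc n)` into `Fin n`.
... | no miss = contradiction
      (Fin.injective⇒≤ {f = λ i → punchOut (y≢g i)}
        (λ {i} {j} eq → inj (Fin.punchOut-injective (y≢g i) (y≢g j) eq)))
      ℕ.1+n≰n
  where
  y≢g : ∀ i → y ≢ g i
  y≢g i eq = miss (i , sym eq)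

listing⇒unique : ∀ X {σ : Vec (V X) n} → IsListing X σ → Unique σ
listing⇒unique X {σ} (inj , _) = subst Unique (Vec.tabulate∘lookup σ) (Unique.tabulate⁺ inj)

-- The labelling gives exactly `n` vertices, so an injective `lookup` on `Fin n` is surjective by
-- pigeonhole.
unique⇒listing : ∀ X → Labelling n X → {σ : Vec (V X) n} → Unique σ → IsListing X σ
unique⇒listing X v {σ} σ! = (λ {i} {j} → inj {i} {j}) , surj
  where
  inj : ∀ {i j} → lookup σ i ≡ lookup σ j → i ≡ j
  inj {i} {j} = Unique.lookup-injective σ! i j

  from-injective : ∀ {x y} → from v x ≡ from v y → x ≡ y
  from-injective eq = trans (sym (strictlyInverseˡ v _)) (trans (cong (to v) eq) (strictlyInverseˡ v _))

  surj : ∀ x → ∃ λ i → ∀ {j} → j ≡ i → lookup σ j ≡ x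
  surj x with injective⇒hits (from v ∘ lookup σ) (inj ∘ from-injective) (from v x)
  ... | i , eq = i , λ { refl → from-injective eq }

words-unique : {as : List A} → ∀ n → Uniqueˡ as → Uniqueˡ (words n as)
words-unique zero    as! = Allˡ.[] ∷ []
words-unique (suc n) as! =
  Uniqueˡ.cartesianProductWith⁺ _∷_ Vec.∷-injective as! (words-unique n as!)

words-complete : {as : List A} → (∀ a → a ∈ as) → (σ : Vec A n) → σ ∈ words n as
words-complete all []      = here refl
words-complete all (a ∷ σ) = ∈.∈-cartesianProductWith⁺ _∷_ (all a) (words-complete all σ)

listings-unique : ∀ X (v : Labelling n X) → Uniqueˡ (listings X v)
listings-unique {n} X v =
  Uniqueˡ.filter⁺ (isListing? X v) (words-unique n (Uniqueˡ.tabulate⁺ (to-injective v)))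

∈-listings⁺ : ∀ X (v : Labelling n X) {σ} → Unique σ → σ ∈ listings X v
∈-listings⁺ X v {σ} σ! = ∈.∈-filter⁺ (isListing? X v)
  (words-complete (λ x → subst (_∈ List.tabulate (to v)) (strictlyInverseˡ v x) (∈.∈-tabulate⁺ (from v x))) σ)
  (unique⇒listing X v σ!)

∈-listings⁻ : ∀ X (v : Labelling n X) {σ} → σ ∈ listings X v → IsListing X σ
∈-listings⁻ X v σ∈ =
  proj₂ (∈.∈-filter⁻ (isListing? X v) {xs = words _ (List.tabulate (to v))} σ∈)

-- Not refl: isListing? also receives the edges.
listings-∖ : ∀ X e (v : Labelling n X) → listings (X ∖ e) v ≡ listings X v
listings-∖ X e v = List.filter-≐ (isListing? (X ∖ e) v) (isListing? X v)
  ((λ {_} → id) , (λ {_} → id)) (words _ (List.tabulate (to v)))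

-- Repetition-free lists with the same members agree as bags, hence up to permutation. Counts can
-- thus be compared through membership alone.
same-elements⇒≡-length : {xs ys : List A} → Uniqueˡ xs → Uniqueˡ ys →
                         (∀ {x} → x ∈ xs → x ∈ ys) → (∀ {x} → x ∈ ys → x ∈ xs) →
                         length xs ≡ length ys
same-elements⇒≡-length xs! ys! ⊆ ⊇ = ↭-length (∼bag⇒↭ (unique∧set⇒bag xs! ys! (mk⇔ ⊆ ⊇)))

-- Friendliness as a condition on consecutive entries

Step : ∀ X → Coloring X → V X → V X → Set
Step X f x y = value (f x) ≤ value (f y) × (E X (x , y) → value (f x) < value (f y))

friendly⇒steps : ∀ X f {σ : Vec (V X) n} → Friendly X f σ → Linked (Step X f) σ
friendly⇒steps X f = Linked.zip

steps⇒friendly : ∀ X f {σ : Vec (V X) n} → Linked (Step X f) σ → Friendly X f σ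
steps⇒friendly X f = Linked.unzip

data Adjacent (x y : A) : Vec A n → Set where
  here  : ∀ {σ : Vec A n} → Adjacent x y (x ∷ y ∷ σ)
  there : ∀ {z} {σ : Vec A n} → Adjacent x y σ → Adjacent x y (z ∷ σ)

adjacent⇒step : ∀ {R : A → A → Set} {x y} {σ : Vec A n} → Adjacent x y σ → Linked R σ → R x y
adjacent⇒step here      (r ∷ _)  = r
adjacent⇒step (there a) (_ ∷ rs) = adjacent⇒step a rs

all-adjacent : ∀ {P : A → Set} {x y} {σ : Vec A n} → Adjacent x y σ → All P σ → P x × P y
all-adjacent here      (px ∷ py ∷ _) = px , py
all-adjacent (there a) (_ ∷ ps)      = all-adjacent a ps

map-injective : ∀ {B : Set} {g : A → B} → (∀ {x y} → g x ≡ g y → x ≡ y) →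
                {σ τ : Vec A n} → Vec.map g σ ≡ Vec.map g τ → σ ≡ τ
map-injective inj {[]}    {[]}    _  = refl
map-injective inj {_ ∷ _} {_ ∷ _} eq =
  cong₂ _∷_ (inj (Vec.∷-injectiveˡ eq)) (map-injective inj (Vec.∷-injectiveʳ eq))

-- Expanding the merged vertex

module Expansion {A : Set} {u v : A} (u≢v : u ≢ v) where

  -- Meant for the entries after an inserted `u`: edges out of `merged` are edges out of `v`. As `v`
  -- is never a kept vertex, `ι` stays injective.
  ι : Contracted u v → A
  ι (kept w _ _) = w
  ι merged       = v

  ι-injective : ∀ {x y} → ι x ≡ ι y → x ≡ y
  ι-injective {kept _ _ _} {kept _ _ _} refl = refl
  ι-injective {kept _ _ q} {merged}     eq   = ⊥-elim-irr (q eq)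
  ι-injective {merged}     {kept _ _ q} eq   = ⊥-elim-irr (q (sym eq))
  ι-injective {merged}     {merged}     _    = refl

  u≢ι : ∀ x → u ≢ ι x
  u≢ι (kept _ p _) eq = ⊥-elim-irr (p (sym eq))
  u≢ι merged       eq = u≢v eq

  -- Replaces the first merged by u , v.  Later occurrences, which a
  -- listing does not have, become v, and a vector without merged gets a
  -- final u; this makes the map total and injective.
  expand : Vec (Contracted u v) n → Vec A (suc n)
  expand []                 = u ∷ []
  expand (kept w _ _ ∷ τ)   = w ∷ expand τ
  expand (merged ∷ τ)       = u ∷ v ∷ Vec.map ι τ

  expand-injective : ∀ {σ τ : Vec (Contracted u v) n} → expand σ ≡ expand τ → σ ≡ τ
  expand-injective {σ = []} {[]} _ = refl
  expand-injective {σ = kept _ _ _ ∷ _} {kept _ _ _ ∷ _} eq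
    with refl ← Vec.∷-injectiveˡ eq = cong (_ ∷_) (expand-injective (Vec.∷-injectiveʳ eq))
  expand-injective {σ = kept _ p _ ∷ _} {merged ∷ _} eq = ⊥-elim-irr (p (Vec.∷-injectiveˡ eq))
  expand-injective {σ = merged ∷ _} {kept _ p _ ∷ _} eq = ⊥-elim-irr (p (sym (Vec.∷-injectiveˡ eq)))
  expand-injective {σ = merged ∷ _} {merged ∷ _} eq =
    cong (merged ∷_) (map-injective ι-injective (Vec.∷-injectiveʳ (Vec.∷-injectiveʳ eq)))

  expand-adjacent : {τ : Vec (Contracted u v) n} → merged ∈ᵛ τ → Adjacent u v (expand τ)
  expand-adjacent {τ = merged ∷ _}     _         = here
  expand-adjacent {τ = kept _ _ _ ∷ _} (there i) = there (expand-adjacent i)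

  ≢-expand : ∀ {w} .{p q} {τ : Vec (Contracted u v) n} →
             All (kept w p q ≢_) τ → All (w ≢_) (expand τ)
  ≢-expand {p = p} []  = (λ eq → ⊥-elim-irr (p eq)) ∷ []
  ≢-expand {τ = kept _ _ _ ∷ _} (≢x ∷ ≢τ) = (λ { refl → ≢x refl }) ∷ ≢-expand ≢τ
  ≢-expand {p = p} {q} {merged ∷ _} (_ ∷ ≢τ) =
    (λ eq → ⊥-elim-irr (p eq)) ∷ (λ eq → ⊥-elim-irr (q eq)) ∷
    All.map⁺ (All.map (λ ≢x eq → ≢x (ι-injective eq)) ≢τ)

  expand-unique : {τ : Vec (Contracted u v) n} → Unique τ → Unique (expand τ)
  expand-unique [] = [] ∷ []
  expand-unique {τ = kept _ _ _ ∷ _} (≢τ ∷ τ!) = ≢-expand ≢τ ∷ expand-unique τ!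
  expand-unique {τ = merged ∷ τ} τ! =
    -- Since `ι merged` is `v`, the part after `u` is `Vec.map ι (merged ∷ τ)`, and `ι` never takes
    -- the value `u`.
    All.map⁺ {xs = merged ∷ τ} (All.universal u≢ι _) ∷ Unique.map⁺ ι-injective τ!

  ≢-expand⁻ : ∀ {w} .{p q} (τ : Vec (Contracted u v) n) →
              All (w ≢_) (expand τ) → All (kept w p q ≢_) τ
  ≢-expand⁻ []               _            = []
  ≢-expand⁻ (kept _ _ _ ∷ τ) (≢x ∷ ≢τ)    = (λ { refl → ≢x refl }) ∷ ≢-expand⁻ τ ≢τ
  ≢-expand⁻ (merged ∷ τ)     (_ ∷ _ ∷ ≢τ) = (λ ()) ∷ All.map (λ ≢x eq → ≢x (cong ι eq)) (All.map⁻ ≢τ)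

  map-ι-preimage : {σ : Vec A n} → All (u ≢_) σ → All (v ≢_) σ →
                   ∃ λ τ → Vec.map ι τ ≡ σ
  map-ι-preimage []        []        = [] , refl
  map-ι-preimage (p ∷ ≢u) (q ∷ ≢v) with τ , refl ← map-ι-preimage ≢u ≢v =
    kept _ (p ∘ sym) (q ∘ sym) ∷ τ , refl

  unique-map-ι⁻ : (τ : Vec (Contracted u v) n) → Unique (Vec.map ι τ) → Unique τ
  unique-map-ι⁻ []      []         = []
  unique-map-ι⁻ (_ ∷ τ) (≢τ ∷ τ!) =
    All.map (λ ≢x eq → ≢x (cong ι eq)) (All.map⁻ ≢τ) ∷ unique-map-ι⁻ τ τ!

  -- Uniqueness keeps `u` and `v` from occurring outside the adjacent pair, so every other entry
  -- lifts to a `kept` vertex.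
  adjacent⇒expansion : {σ : Vec A (suc n)} → Unique σ → Adjacent u v σ →
                       ∃ λ τ → expand τ ≡ σ × Unique τ × merged ∈ᵛ τ
  adjacent⇒expansion ((_ ∷ ≢u) ∷ vσ!@(≢v ∷ _)) here with τ , refl ← map-ι-preimage ≢u ≢v =
    merged ∷ τ , refl , unique-map-ι⁻ (merged ∷ τ) vσ! , here refl
  adjacent⇒expansion {n = zero} _ (there ())
  adjacent⇒expansion {n = suc _} (≢σ ∷ σ!) (there a)
    with τ , refl , τ! , i ← adjacent⇒expansion σ! a | p , q ← all-adjacent a ≢σ =
    kept _ p q ∷ τ , refl , ≢-expand⁻ τ ≢σ ∷ τ! , there i

-- Friendly listings under deletion and contraction

contractColoring : ∀ X {u v} → Coloring X → Coloring (X / (u , v))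
contractColoring X         f (kept w _ _) = f w
contractColoring X {u = u} f merged       = f u

module _ (X : Digraph) {u v : V X} (u≢v : u ≢ v) (f : Coloring X) where
  open Expansion u≢v
  open Digraph X using (_≟_)

  private
    X∖e = X ∖ (u , v)
    X/e = X / (u , v)

  private
    f′ = contractColoring X {u} {v} f

  steps-∖ : {σ : Vec (V X) n} → Linked (Step X f) σ → Linked (Step X∖e f) σ
  steps-∖ = Linked.map λ { (le , lt) → le , lt ∘ proj₁ }

  -- Only the pair `u`, `v` regains a strictness condition, and there a weak inequality between
  -- distinct colors is already strict.
  steps-∖⁻ : f u ≢ f v → {σ : Vec (V X) n} → Linked (Step X∖e f) σ → Linked (Step X f) σ
  steps-∖⁻ fu≢fv = Linked.map λ {x} {y} → restore {x} {y}
    where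
    restore : ∀ {x y} → Step X∖e f x y → Step X f x y
    restore {x} {y} (le , lt) with x ≟ u | y ≟ v
    ... | yes refl | yes refl = le , λ _ → ℕ.≤∧≢⇒< le (fu≢fv ∘ value-injective)
    ... | no x≢u   | _        = le , λ e → lt (e , x≢u ∘ cong proj₁)
    ... | yes _    | no y≢v   = le , λ e → lt (e , y≢v ∘ cong proj₂)

  -- Restoring the edge can only affect a place where `u` directly precedes `v`. The alternatives
  -- may overlap in general; `¬adjacent-steps` separates them when `f u ≡ f v` and the edge is
  -- present.
  steps-∖-dichotomy : {σ : Vec (V X) n} → Linked (Step X∖e f) σ →
                      Linked (Step X f) σ ⊎ Adjacent u v σ
  steps-∖-dichotomy []  = inj₁ []
  steps-∖-dichotomy [-] = inj₁ [-]
  steps-∖-dichotomy {σ = x ∷ y ∷ _} ((le , lt) ∷ ss) with x ≟ u | y ≟ v | steps-∖-dichotomy ss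
  ... | yes refl | yes refl | _       = inj₂ here
  ... | _        | _        | inj₂ a  = inj₂ (there a)
  ... | no x≢u   | _        | inj₁ ss′ = inj₁ ((le , λ e → lt (e , x≢u ∘ cong proj₁)) ∷ ss′)
  ... | yes _    | no y≢v   | inj₁ ss′ = inj₁ ((le , λ e → lt (e , y≢v ∘ cong proj₂)) ∷ ss′)

  module _ (fu≡fv : f u ≡ f v) where

    ¬adjacent-steps : E X (u , v) → {σ : Vec (V X) n} → Adjacent u v σ → ¬ Linked (Step X f) σ
    ¬adjacent-steps uv∈E a ss = ℕ.<-irrefl (cong value fu≡fv) (proj₂ (adjacent⇒step a ss) uv∈E)

    -- The target must not be `merged`, whose incoming edges are those of `u`, whereas `ι merged` is
    -- `v`. For `x` equal to `merged`, the colors match through `f u ≡ f v`.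
    step-ι : ∀ {x y} → merged ≢ y → Step X/e f′ x y → Step X∖e f (ι x) (ι y)
    step-ι {_}          {merged}     ≢y _         = contradiction refl ≢y
    step-ι {kept _ _ _} {kept _ _ _} _ (le , lt) = le , lt ∘ proj₁
    step-ι {merged}     {kept _ _ _} _ (le , lt) rewrite sym fu≡fv = le , lt ∘ proj₁

    -- The pair `ι x`, `ι y` is never the deleted edge, because `ι x` differs from `u`.
    step-ι⁻ : ∀ {x y} → merged ≢ y → Step X∖e f (ι x) (ι y) → Step X/e f′ x y
    step-ι⁻ {_}          {merged}     ≢y _         = contradiction refl ≢y
    step-ι⁻ {kept _ p _} {kept _ _ _} _ (le , lt) =
      le , λ e → lt (e , λ eq → ⊥-elim-irr (p (cong proj₁ eq)))
    step-ι⁻ {merged}     {kept _ _ _} _ (le , lt) rewrite sym fu≡fv =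
      le , λ e → lt (e , λ eq → u≢v (sym (cong proj₁ eq)))

    steps-ι : ∀ {x} {τ : Vec (V X/e) n} → All (merged ≢_) τ →
              Linked (Step X/e f′) (x ∷ τ) → Linked (Step X∖e f) (ι x ∷ Vec.map ι τ)
    steps-ι []        [-]      = [-]
    steps-ι {x = x} (≢y ∷ ≢τ) (s ∷ ss) = step-ι {x} ≢y s ∷ steps-ι ≢τ ss

    steps-ι⁻ : ∀ {x} {τ : Vec (V X/e) n} → All (merged ≢_) τ →
               Linked (Step X∖e f) (ι x ∷ Vec.map ι τ) → Linked (Step X/e f′) (x ∷ τ)
    steps-ι⁻ []        [-]      = [-]
    steps-ι⁻ {x = x} (≢y ∷ ≢τ) (s ∷ ss) = step-ι⁻ {x} ≢y s ∷ steps-ι⁻ ≢τ ss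

    -- A step into `merged` becomes a step into `u`, the vertex whose incoming edges and color
    -- `merged` inherits.
    step-expand : ∀ {w} .{p q} (τ : Vec (V X/e) (suc n)) →
                  Step X/e f′ (kept w p q) (Vec.head τ) → Step X∖e f w (Vec.head (expand τ))
    step-expand (kept _ _ _ ∷ _) (le , lt) = le , lt ∘ proj₁
    step-expand (merged ∷ _)     (le , lt) = le , lt ∘ proj₁

    step-expand⁻ : ∀ {w} .{p q} (τ : Vec (V X/e) (suc n)) →
                   Step X∖e f w (Vec.head (expand τ)) → Step X/e f′ (kept w p q) (Vec.head τ)
    step-expand⁻ {p = p} (kept _ _ _ ∷ _) (le , lt) =
      le , λ e → lt (e , λ eq → ⊥-elim-irr (p (cong proj₁ eq)))
    step-expand⁻ {p = p} (merged ∷ _) (le , lt) =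
      le , λ e → lt (e , λ eq → ⊥-elim-irr (p (cong proj₁ eq)))

    expand-steps : {τ : Vec (V X/e) n} → Unique τ → merged ∈ᵛ τ →
                   Linked (Step X/e f′) τ → Linked (Step X∖e f) (expand τ)
    expand-steps {τ = merged ∷ _} (≢τ ∷ _) _ ss =
      -- From `u` to `v`, equal colors give the weak inequality, and strictness is vacuous as the
      -- edge is deleted. Uniqueness excludes a second `merged` from the tail, as `steps-ι`
      -- requires.
      (ℕ.≤-reflexive (cong value fu≡fv) , λ (_ , ≢uv) → contradiction refl ≢uv) ∷ steps-ι ≢τ ss
    expand-steps {τ = kept _ _ _ ∷ τ@(_ ∷ _)} (_ ∷ τ!) (there i) (s ∷ ss) =
      step-expand τ s ∷ expand-steps τ! i ss

    expand-steps⁻ : {τ : Vec (V X/e) n} → Unique τ → merged ∈ᵛ τ →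
                    Linked (Step X∖e f) (expand τ) → Linked (Step X/e f′) τ
    expand-steps⁻ {τ = merged ∷ _} (≢τ ∷ _) _ (_ ∷ ss) = steps-ι⁻ ≢τ ss
    expand-steps⁻ {τ = kept _ _ _ ∷ τ@(_ ∷ _)} (_ ∷ τ!) (there i) (s ∷ ss) =
      step-expand⁻ τ s ∷ expand-steps⁻ τ! i ss

    #friendly-split : E X (u , v) → (v₁ : Labelling (suc n) X) (v₂ : Labelling n X/e) →
                      #friendly X∖e v₁ f ≡ #friendly X v₁ f + #friendly X/e v₂ f′
    #friendly-split {n} uv∈E v₁ v₂ = trans
      (same-elements⇒≡-length
        (Uniqueˡ.filter⁺ (friendly? X∖e f) (listings-unique X∖e v₁))
        (Uniqueˡ.++⁺ (Uniqueˡ.filter⁺ (friendly? X f) (listings-unique X v₁))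
          (Uniqueˡ.map⁺ expand-injective
            (Uniqueˡ.filter⁺ (friendly? X/e f′) (listings-unique X/e v₂)))
          disjoint)
        split merge)
      (trans (List.length-++ friendly)
             (cong (length friendly +_) (List.length-map expand contracted)))
      where
      friendly : List (Vec (V X) (suc n))
      friendly = filter (friendly? X f) (listings X v₁)

      contracted : List (Vec (V X/e) n)
      contracted = filter (friendly? X/e f′) (listings X/e v₂)

      contracted-inv : ∀ {τ} → τ ∈ contracted →
                       Unique τ × merged ∈ᵛ τ × Linked (Step X/e f′) τ
      contracted-inv {τ} τ∈ with τ∈L , fr ← ∈.∈-filter⁻ (friendly? X/e f′) {xs = listings X/e v₂} τ∈
        -- Surjectivity of the listing supplies the occurrence of `merged`.
        with isL@(_ , surj) ← ∈-listings⁻ X/e v₂ τ∈L with i , hit ← surj merged =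
        listing⇒unique X/e isL , subst (_∈ᵛ τ) (hit refl) (∈ᵛ.∈-lookup i τ) , friendly⇒steps X/e f′ fr

      -- An expansion puts `u` right before `v`; friendliness for `X` would force a strict
      -- inequality between their equal colors.
      disjoint : ∀ {σ} → ¬ (σ ∈ friendly × σ ∈ List.map expand contracted)
      disjoint (σ∈ , σ∈′) with τ , τ∈ , refl ← ∈.∈-map⁻ expand σ∈′ with _ , i , _ ← contracted-inv τ∈ =
        ¬adjacent-steps uv∈E (expand-adjacent i)
          (friendly⇒steps X f (proj₂ (∈.∈-filter⁻ (friendly? X f) {xs = listings X v₁} σ∈)))

      split : ∀ {σ} → σ ∈ filter (friendly? X∖e f) (listings X∖e v₁) →
              σ ∈ friendly ++ List.map expand contracted
      split σ∈ with σ∈L , fr ← ∈.∈-filter⁻ (friendly? X∖e f) {xs = listings X∖e v₁} σ∈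
        with steps-∖-dichotomy (friendly⇒steps X∖e f fr)
      ... | inj₁ ss = ∈.∈-++⁺ˡ (∈.∈-filter⁺ (friendly? X f)
        (subst (_ ∈_) (listings-∖ X (u , v) v₁) σ∈L) (steps⇒friendly X f ss))
      ... | inj₂ a with τ , refl , τ! , i ← adjacent⇒expansion (listing⇒unique X∖e (∈-listings⁻ X∖e v₁ σ∈L)) a =
        ∈.∈-++⁺ʳ friendly (∈.∈-map⁺ expand (∈.∈-filter⁺ (friendly? X/e f′) (∈-listings⁺ X/e v₂ τ!)
          (steps⇒friendly X/e f′ (expand-steps⁻ τ! i (friendly⇒steps X∖e f fr)))))

      merge : ∀ {σ} → σ ∈ friendly ++ List.map expand contracted →
              σ ∈ filter (friendly? X∖e f) (listings X∖e v₁)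
      merge σ∈ with ∈.∈-++⁻ friendly σ∈
      ... | inj₁ σ∈X with σ∈L , fr ← ∈.∈-filter⁻ (friendly? X f) {xs = listings X v₁} σ∈X =
        ∈.∈-filter⁺ (friendly? X∖e f) (subst (_ ∈_) (sym (listings-∖ X (u , v) v₁)) σ∈L)
          (steps⇒friendly X∖e f (steps-∖ (friendly⇒steps X f fr)))
      ... | inj₂ σ∈′ with τ , τ∈ , refl ← ∈.∈-map⁻ expand σ∈′ with τ! , i , ss ← contracted-inv τ∈ =
        ∈.∈-filter⁺ (friendly? X∖e f) (∈-listings⁺ X∖e v₁ (expand-unique τ!))
          (steps⇒friendly X∖e f (expand-steps τ! i ss))

  #friendly-∖ : f u ≢ f v → (v₁ : Labelling n X) → #friendly X∖e v₁ f ≡ #friendly X v₁ f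
  #friendly-∖ fu≢fv v₁ = cong length (trans
    (cong (filter (friendly? X∖e f)) (listings-∖ X (u , v) v₁))
    (List.filter-≐ (friendly? X∖e f) (friendly? X f)
      ( (λ {σ} → steps⇒friendly X f ∘ steps-∖⁻ fu≢fv ∘ friendly⇒steps X∖e f {σ = σ})
      , (λ {σ} → steps⇒friendly X∖e f ∘ steps-∖ ∘ friendly⇒steps X f {σ = σ})) (listings X v₁)))

-- Coefficients of induced series

last-∷ʳ : ∀ (as : List A) a → last (as ∷ʳ a) ≡ just a
last-∷ʳ []           a = refl
last-∷ʳ (_ ∷ [])     a = refl
last-∷ʳ (_ ∷ b ∷ as) a = last-∷ʳ (b ∷ as) a

tabulate-∷ʳ : (g : Fin (suc n) → A) → List.tabulate g ≡ List.tabulate (g ∘ inject₁) ∷ʳ g (fromℕ n)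
tabulate-∷ʳ {zero}  g = refl
tabulate-∷ʳ {suc n} g = cong (g zero ∷_) (tabulate-∷ʳ (g ∘ suc))

-- The word is a variable tied to `u ∷ʳ b` by an equation, so that matching on `initLast w` can
-- refine it.
↑-repeated : ∀ F {w} u {b} → w ≡ u ∷ʳ b → last u ≡ just b → (F ↑) w ≡ F u
↑-repeated F {w} u w≡ last≡ with initLast w
... | [] = contradiction (sym w≡) (∷ʳ≢[] u)
  where
  ∷ʳ≢[] : ∀ (as : List A) {a} → as ∷ʳ a ≢ []
  ∷ʳ≢[] []      ()
  ∷ʳ≢[] (_ ∷ _) ()
... | u′ ∷ʳ′ b′ with refl , refl ← List.∷ʳ-injective u′ u w≡ with Maybe.≡-dec _≟ℙ_ (last u′) (just b′)
...   | yes _    = refl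
...   | no last≢ = contradiction last≡ last≢

-- Serves two situations: the last two letters differ, making the premise vacuous, or `F` vanishes
-- at `u` for reasons of degree.
↑-zero : ∀ F {w} → (∀ u b → w ≡ u ∷ʳ b → last u ≡ just b → F u ≡ 0ℤ) → (F ↑) w ≡ 0ℤ
↑-zero F {w} h with initLast w
... | [] = refl
... | u ∷ʳ′ b with Maybe.≡-dec _≟ℙ_ (last u) (just b)
...   | yes last≡ = h u b refl last≡
...   | no  _     = refl

W-degree : ∀ X (v : Labelling n X) w → length w ≢ n → W X v w ≡ 0ℤ
W-degree {n} X v w ≢n with length w ℕ.≟ n
... | yes ≡n = contradiction ≡n ≢n
... | no  _  = refl

colorMonomial-surjective : ∀ X (v : Labelling n X) w → length w ≡ n →
                           ∃ λ f → w ≡ colorMonomial X v f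
colorMonomial-surjective X v w refl = List.lookup w ∘ from v ,
  sym (trans (List.tabulate-cong (λ i → cong (List.lookup w) (strictlyInverseʳ v i)))
             (List.tabulate-lookup w))

-- Comparison of coefficients

module _ {m : ℕ} (X : Digraph) (v : Labelling (2 + m) X) where
  private
    p = to v (penultimate m)
    q = to v (ultimate m)
    X∖e = X ∖ lastPair X v
    X/e = X / lastPair X v
    v′ = contractLabelling X v

  p≢q : p ≢ q
  p≢q eq = Fin.fromℕ≢inject₁ (sym (to-injective v eq))

  contractColoring-label : ∀ f i → contractColoring X f (to v′ i) ≡ f (to v (inject₁ i))
  contractColoring-label f i with view i
  ... | ‵fromℕ     = refl
  ... | ‵inject₁ k = refl

  -- `merged` carries the last label of `X/e` and the color `f p`, so contraction drops exactly the
  -- last letter, even when `f p` and `f q` differ.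
  colorMonomial-∷ʳ : ∀ f → colorMonomial X v f ≡
                           colorMonomial X/e v′ (contractColoring X f) ∷ʳ f q
  colorMonomial-∷ʳ f = trans (tabulate-∷ʳ (f ∘ to v))
    (cong (_∷ʳ f q) (List.tabulate-cong (sym ∘ contractColoring-label f)))

  last-colorMonomial : ∀ f → last (colorMonomial X/e v′ (contractColoring X f)) ≡ just (f p)
  last-colorMonomial f = trans
    (cong last (trans (List.tabulate-cong (contractColoring-label f)) (tabulate-∷ʳ (f ∘ to v ∘ inject₁))))
    (last-∷ʳ (List.tabulate (λ k → f (to v (inject₁ (inject₁ k))))) (f p))

  W↑-coefficient : ∀ f → f p ≡ f q →
                   (W X/e v′ ↑) (colorMonomial X v f) ≡
                   ℤ.+ #friendly X/e v′ (contractColoring X f)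
  W↑-coefficient f fp≡fq = trans
    (↑-repeated (W X/e v′) _ (colorMonomial-∷ʳ f) (trans (last-colorMonomial f) (cong just fp≡fq)))
    (W-coefficient X/e v′ (contractColoring X f))

  W↑-zero : ∀ f → f p ≢ f q → (W X/e v′ ↑) (colorMonomial X v f) ≡ 0ℤ
  W↑-zero f fp≢fq = ↑-zero (W X/e v′) λ u b w≡ last≡ → contradiction
    -- Splitting off the last letter identifies `b` with `f q` and `u` with the contracted monomial,
    -- which ends in `f p`; `last≡` then equates the two colors.
    (case List.∷ʳ-injective (colorMonomial X/e v′ (contractColoring X f)) u (trans (sym (colorMonomial-∷ʳ f)) w≡) of λ
      { (refl , refl) → Maybe.just-injective (trans (sym (last-colorMonomial f)) last≡) })
    fp≢fq

  -- Since `_↑` raises the degree by one, a word of degree other than `2 + m` can only come from one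
  -- of degree other than `1 + m`, so all terms vanish.
  W-degree-≢ : ∀ {w} → length w ≢ 2 + m → W X v w ≡ (W X∖e v - W X/e v′ ↑) w
  W-degree-≢ {w} ≢n = trans (W-degree X v w ≢n)
    (sym (cong₂ ℤ._-_ (W-degree X∖e v w ≢n) (↑-zero (W X/e v′) {w} λ u b w≡ _ →
      W-degree X/e v′ u λ |u| → ≢n (trans (cong length w≡)
        (trans (List.length-++-comm u (b ∷ [])) (cong suc |u|))))))

  W-colorMonomial : E X (p , q) → ∀ f → W X v (colorMonomial X v f) ≡
                          (W X∖e v - W X/e v′ ↑) (colorMonomial X v f)
  W-colorMonomial e f = trans (W-coefficient X v f)
    (trans difference (sym (cong (ℤ._- (W X/e v′ ↑) (colorMonomial X v f)) (W-coefficient X∖e v f))))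
    where
    difference : ℤ.+ #friendly X v f ≡
                 ℤ.+ #friendly X∖e v f ℤ.- (W X/e v′ ↑) (colorMonomial X v f)
    difference with f p ≟ℙ f q
    ... | no fp≢fq = sym (trans (cong₂ (λ a b → ℤ.+ a ℤ.- b) (#friendly-∖ X p≢q f fp≢fq v) (W↑-zero f fp≢fq))
                                (ℤ.+-identityʳ _))
    ... | yes fp≡fq = sym (trans
      (cong₂ (λ a b → ℤ.+ a ℤ.- b) (#friendly-split X p≢q f fp≡fq e v v′) (W↑-coefficient f fp≡fq))
      -- The natural sum in the split computes to an integer sum, from which the contracted count
      -- cancels.
      (//-rightDividesʳ (ℤ.+ #friendly X/e v′ (contractColoring X f)) (ℤ.+ #friendly X v f)))

theorem3p7 : ∀ {m : ℕ} (X : Digraph) (v : Labelling (2 + m) X) →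
    let e = lastPair X v in
    Digraph.E X e →
    W X v ≗ W (X ∖ e) v - W (X / e) (contractLabelling X v) ↑
theorem3p7 {m} X v e w = case length w ℕ.≟ 2 + m of λ where
  (no |w|≢n)  → W-degree-≢ X v |w|≢n
  -- Every word of full degree is the monomial of the coloring read off along the labelling.
  (yes |w|≡n) → let f , w≡ = colorMonomial-surjective X v w |w|≡n in
    subst (λ w → W X v w ≡ (W (X ∖ lastPair X v) v - W (X / lastPair X v) (contractLabelling X v) ↑) w)
          (sym w≡) (W-colorMonomial X v e f)
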